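{- Let $A_1,A_2$ be the $4\times4$ matrices over $\mathbb{R}_{\max}$ whose only entries different from $\varepsilon=-\infty$ are the following. For both $s=1,2$: $(A_s)_{1,1}=(A_s)_{2,2}=(A_s)_{3,3}=0$ and $(A_s)_{3,4}=(A_s)_{4,1}=-100$; moreover $(A_1)_{1,2}=(A_1)_{2,3}=-100$ and $(A_2)_{1,2}=(A_2)_{2,3}=-1$. (Their common critical digraph consists of three strongly connected components, the loops at nodes $1$, $2$, $3$; both it and the common associated digraph have cyclicity $1$.) Then for every $t\ge2$ the product $(A_1)^t\otimes A_2$ is not CSR. Consequently, there are arbitrarily long products of matrices from $\{A_1,A_2\}$ that are not CSR.
   Context: $\mathbb{R}_{\max}=\mathbb{R}\cup\{ -\infty\}$ with $a\oplus b=\max(a,b)$, $a\otimes b=a+b$; $(A\otimes B)_{i,j}=\max_l(a_{i,l}+b_{l,j})$; matrix powers are tropical and $A^0=I$ ($0$ on the diagonal, $\varepsilon$ elsewhere). The digraph associated with a square matrix $A$ has an edge $(i,j)$ of weight $a_{i,j}$ iff $a_{i,j}\ne\varepsilon$. The critical digraph of $A$ consists of all nodes and edges on cycles whose mean weight (weight/length) is maximal. The cyclicity of a strongly connected digraph is the gcd of its cycle lengths; that of a disjoint union of strongly connected components is the lcm of their cyclicities. CSR: let $\mathcal{E}_c$ be the edge set of the common critical digraph of the matrices in the set, $\gamma$ its cyclicity, $S$ the matrix with $S_{i,j}=0$ for $(i,j)\in\mathcal{E}_c$ and $\varepsilon$ otherwise, $T(S)$ the least $T$ with $S^{l+\gamma}=S^l$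 for all $l\ge T$, and $t_0$ any integer with $t_0\gamma\ge T(S)$. For a product $\Gamma(k)$ of $k$ matrices from the set, and $k\,(\mathrm{mod}\,\gamma)\in\{0,\dots,\gamma-1\}$, put $C=\Gamma(k)\otimes S^{(t_0+1)\gamma-k(\mathrm{mod}\,\gamma)}$ and $R=S^{(t_0+1)\gamma-k(\mathrm{mod}\,\gamma)}\otimes\Gamma(k)$. $\Gamma(k)$ is called CSR if $\Gamma(k)=C\otimes S^{k(\mathrm{mod}\,\gamma)}\otimes R$. -}

module Defs where

open import Data.Bool.Base using (if_then_else_)
open import Data.Empty using (⊥-elim)
open import Data.Fin.Base using (Fin)
open import Data.Fin.Patterns using (0F; 1F; 2F)
open import Data.Fin.Properties using (_≟_)
open import Data.Integer.Base as ℤ using (ℤ; +_)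
open import Data.List.Base as List using (List; []; _∷_)
open import Data.List.Membership.Propositional using (_∈_)
open import Data.List.Membership.Propositional.Properties using (∈-map⁺)
open import Data.List.Relation.Unary.Any using (here; there)
open import Data.List.Relation.Unary.Unique.Propositional using (Unique)
open import Data.Nat.Base as ℕ using (ℕ; zero; suc; NonZero)
open import Data.Nat.Divisibility using (_∣_)
open import Data.Nat.DivMod using (_%_)
import Data.Nat.Properties as ℕ
import Data.Nat.Solver as ℕSolver
open import Data.Product using (Σ-syntax; ∃-syntax; _×_; _,_; proj₁; proj₂)
open import Data.Rational.Base as ℚ using (ℚ; 0ℚ; 1ℚ)
open import Data.Rational.Literals using (fromℤ)
import Data.Rational.Properties as ℚ
open import Data.Rational.Solver using (module +-*-Solver)
open import Data.Rational.Unnormalised.Base as ℚᵘ using (mkℚᵘ; *≡*)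
import Data.Rational.Unnormalised.Properties as ℚᵘ
open import Data.Sum.Base using (_⊎_; inj₁; inj₂)
open import Data.Unit.Base using (⊤; tt)
open import Data.Vec.Base as Vec using (Vec; lookup; []; _∷_)
import Data.Vec.Functional as Vector
open import Function.Bundles using (_⇔_)
open import Relation.Binary.Construct.Closure.ReflexiveTransitive
  using (Star; _◅_) renaming (ε to done)
open import Relation.Binary.PropositionalEquality
open import Relation.Nullary.Construct.Add.Infimum using (_₋; ⊥₋; [_])
open import Relation.Nullary.Decidable.Core using (Dec; does)

------------------------------------------------------------------------
-- The real numbers, as regular Cauchy sequences of rationals (Bishop)

δ : ℕ → ℚ
δ n = + 1 ℚ./ suc n

-- Exchanging m and n turns `regular` into the usual
-- ∣ seq m - seq n ∣ ≤ 1/(m+1) + 1/(n+1).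
record ℝ : Set where
  field
    seq     : ℕ → ℚ
    regular : ∀ m n → seq m ℚ.≤ seq n ℚ.+ (δ m ℚ.+ δ n)
open ℝ public

infix 4 _≤ᴿ_ _≈ᴿ_

_≤ᴿ_ : ℝ → ℝ → Set
x ≤ᴿ y = ∀ n → seq x n ℚ.≤ seq y n ℚ.+ (δ n ℚ.+ δ n)

_≈ᴿ_ : ℝ → ℝ → Set
x ≈ᴿ y = x ≤ᴿ y × y ≤ᴿ x

private
  0≤/ : ∀ d .{{_ : NonZero d}} → 0ℚ ℚ.≤ + 1 ℚ./ d
  0≤/ d = ℚ.nonNegative⁻¹ (+ 1 ℚ./ d) {{ℚ.normalize-nonNeg 1 d}}

  /≤1 : ∀ d .{{_ : NonZero d}} → + 1 ℚ./ d ℚ.≤ 1ℚ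
  /≤1 (suc d) = ℚ.toℚᵘ-cancel-≤
    (ℚᵘ.≤-respˡ-≃ (ℚᵘ.≃-sym (ℚ.toℚᵘ-fromℚᵘ (mkℚᵘ (+ 1) d)))
      (ℚᵘ.*≤* (ℤ.+≤+ (ℕ.s≤s ℕ.z≤n))))

  0≤δ+δ : ∀ m n → 0ℚ ℚ.≤ δ m ℚ.+ δ n
  0≤δ+δ m n = ℚ.+-mono-≤ (0≤/ (suc m)) (0≤/ (suc n))

  p≤p+ : ∀ p {e} → 0ℚ ℚ.≤ e → p ℚ.≤ p ℚ.+ e
  p≤p+ p 0≤e = subst (ℚ._≤ p ℚ.+ _) (ℚ.+-identityʳ p) (ℚ.+-monoʳ-≤ p 0≤e)

-- 1/(double n + 1) is half of 1/(n + 1).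
double : ℕ → ℕ
double n = suc (n ℕ.+ n)

private
  δ-double : ∀ n → δ (double n) ℚ.+ δ (double n) ≡ δ n
  δ-double n = ℚ.toℚᵘ-injective (begin
    ℚ.toℚᵘ (δ (double n) ℚ.+ δ (double n))
      ≈⟨ ℚ.toℚᵘ-homo-+ (δ (double n)) (δ (double n)) ⟩
    ℚ.toℚᵘ (δ (double n)) ℚᵘ.+ ℚ.toℚᵘ (δ (double n))
      ≈⟨ ℚᵘ.+-cong (ℚ.toℚᵘ-fromℚᵘ (mkℚᵘ (+ 1) (double n)))
                   (ℚ.toℚᵘ-fromℚᵘ (mkℚᵘ (+ 1) (double n))) ⟩
    mkℚᵘ (+ 1) (double n) ℚᵘ.+ mkℚᵘ (+ 1) (double n)
      ≈⟨ *≡* (cong +_ (arith n)) ⟩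
    mkℚᵘ (+ 1) n
      ≈⟨ ℚᵘ.≃-sym (ℚ.toℚᵘ-fromℚᵘ (mkℚᵘ (+ 1) n)) ⟩
    ℚ.toℚᵘ (δ n) ∎)
    where
    open import Relation.Binary.Reasoning.Setoid ℚᵘ.≃-setoid
    open ℕSolver.+-*-Solver
    arith : ∀ n → (1 ℕ.* suc (double n) ℕ.+ 1 ℕ.* suc (double n)) ℕ.* suc n
                  ≡ 1 ℕ.* (suc (double n) ℕ.* suc (double n))
    arith = solve 1 (λ n → let d = con 2 :+ (n :+ n) in
      (con 1 :* d :+ con 1 :* d) :* (con 1 :+ n) := con 1 :* (d :* d)) refl

real : ℤ → ℝ
real z = record
  { seq     = λ _ → fromℤ z
  ; regular = λ m n → p≤p+ (fromℤ z) (0≤δ+δ m n)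
  }

infixl 6 _+ᴿ_ _⊔ᴿ_
infixl 7 _÷_

_+ᴿ_ : ℝ → ℝ → ℝ
x +ᴿ y = record
  { seq     = λ n → seq x (double n) ℚ.+ seq y (double n)
  ; regular = λ m n → let m′ = double m ; n′ = double n in
      subst (seq x m′ ℚ.+ seq y m′ ℚ.≤_)
        (trans (shuffle (seq x n′) (seq y n′) (δ m′) (δ n′))
          (cong (seq x n′ ℚ.+ seq y n′ ℚ.+_)
            (cong₂ ℚ._+_ (δ-double m) (δ-double n))))
        (ℚ.+-mono-≤ (regular x m′ n′) (regular y m′ n′))
  }
  where
  open +-*-Solver
  shuffle : ∀ p q a b → (p ℚ.+ (a ℚ.+ b)) ℚ.+ (q ℚ.+ (a ℚ.+ b))
                        ≡ (p ℚ.+ q) ℚ.+ ((a ℚ.+ a) ℚ.+ (b ℚ.+ b))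
  shuffle = solve 4 (λ p q a b → (p :+ (a :+ b)) :+ (q :+ (a :+ b))
                        := (p :+ q) :+ ((a :+ a) :+ (b :+ b))) refl

_⊔ᴿ_ : ℝ → ℝ → ℝ
x ⊔ᴿ y = record
  { seq     = λ n → seq x n ℚ.⊔ seq y n
  ; regular = λ m n → let e = δ m ℚ.+ δ n in ℚ.⊔-lub
      (ℚ.≤-trans (regular x m n) (ℚ.+-monoˡ-≤ e (ℚ.p≤p⊔q (seq x n) (seq y n))))
      (ℚ.≤-trans (regular y m n) (ℚ.+-monoˡ-≤ e (ℚ.p≤q⊔p (seq x n) (seq y n))))
  }

_÷_ : ℝ → (d : ℕ) .{{_ : NonZero d}} → ℝ
x ÷ d = record
  { seq     = λ n → seq x n ℚ.* c
  ; regular = λ m n → let e = δ m ℚ.+ δ n in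
      ℚ.≤-trans (ℚ.*-monoʳ-≤-nonNeg c {{0≤c}} (regular x m n))
        (subst (ℚ._≤ seq x n ℚ.* c ℚ.+ e) (sym (ℚ.*-distribʳ-+ c (seq x n) e))
          (ℚ.+-monoʳ-≤ (seq x n ℚ.* c)
            (subst (e ℚ.* c ℚ.≤_) (ℚ.*-identityʳ e)
              (ℚ.*-monoˡ-≤-nonNeg e {{ℚ.nonNegative (0≤δ+δ m n)}} (/≤1 d)))))
  }
  where
  c : ℚ
  c = + 1 ℚ./ d
  0≤c : ℚ.NonNegative c
  0≤c = ℚ.normalize-nonNeg 1 d

------------------------------------------------------------------------
-- The max-plus semiring ℝ ∪ {-∞} and its matrices

ℝmax : Set
ℝmax = ℝ ₋

open import Relation.Binary.Construct.Add.Infimum.Equality _≈ᴿ_ public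
  using (_≈₋_)

ε : ℝmax
ε = ⊥₋

infixl 6 _⊕_
infixl 7 _⊙_

_⊕_ : ℝmax → ℝmax → ℝmax
⊥₋    ⊕ b     = b
[ x ] ⊕ ⊥₋    = [ x ]
[ x ] ⊕ [ y ] = [ x ⊔ᴿ y ]

_⊙_ : ℝmax → ℝmax → ℝmax
[ x ] ⊙ [ y ] = [ x +ᴿ y ]
[ x ] ⊙ ⊥₋    = ⊥₋
⊥₋    ⊙ b     = ⊥₋

Matrix : ℕ → Set
Matrix n = Fin n → Fin n → ℝmax

infix  4 _≈ᴹ_
infixl 7 _⊗_
infixr 8 _^_

_≈ᴹ_ : ∀ {n} → Matrix n → Matrix n → Set
A ≈ᴹ B = ∀ i j → A i j ≈₋ B i j

_⊗_ : ∀ {n} → Matrix n → Matrix n → Matrix n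
(A ⊗ B) i j = Vector.foldr _⊕_ ε (λ l → A i l ⊙ B l j)

I : ∀ {n} → Matrix n
I i j = if does (i ≟ j) then [ real (+ 0) ] else ε

_^_ : ∀ {n} → Matrix n → ℕ → Matrix n
A ^ zero  = I
A ^ suc k = A ⊗ (A ^ k)

product : ∀ {n k} → Vec (Matrix n) k → Matrix n
product = Vec.foldr′ _⊗_ I

------------------------------------------------------------------------
-- Digraphs, walks and cycles

record Digraph (n : ℕ) : Set₁ where
  field
    Node : Fin n → Set
    Edge : Fin n → Fin n → Set
    ends : ∀ {i j} → Edge i j → Node i × Node j
open Digraph public

infix 4 _≈ᴳ_

_≈ᴳ_ : ∀ {n} → Digraph n → Digraph n → Set
G ≈ᴳ H = (∀ i → Node G i ⇔ Node H i) × (∀ i j → Edge G i j ⇔ Edge H i j)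

Walk : ∀ {n} → Digraph n → Fin n → Fin n → Set
Walk G = Star (Edge G)

module _ {n} {G : Digraph n} where

  edges : ∀ {i j} → Walk G i j → List (Fin n × Fin n)
  edges done              = []
  edges (_◅_ {i} {j} _ w) = (i , j) ∷ edges w

  -- All nodes visited except the final one, with repetitions.
  sources : ∀ {i j} → Walk G i j → List (Fin n)
  sources w = List.map proj₁ (edges w)

  length : ∀ {i j} → Walk G i j → ℕ
  length done    = 0
  length (_ ◅ w) = suc (length w)

-- Cycles are elementary: no node repeats apart from the first being the last.
record Cycle {n} (G : Digraph n) : Set where
  field
    {start next} : Fin n
    first        : Edge G start next
    rest         : Walk G next start

  walk : Walk G start start
  walk = first ◅ rest

  field
    elementary : Unique (sources {G = G} walk)

  cycleLength : ℕ
  cycleLength = length {G = G} walk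

  OnCycle : Fin n → Set
  OnCycle i = i ∈ sources {G = G} walk

  EdgeOnCycle : Fin n × Fin n → Set
  EdgeOnCycle e = e ∈ edges {G = G} walk
open Cycle public

------------------------------------------------------------------------
-- Cyclicity

IsGCD : (ℕ → Set) → ℕ → Set
IsGCD P d = (∀ l → P l → d ∣ l) × (∀ e → (∀ l → P l → e ∣ l) → e ∣ d)

IsLCM : (ℕ → Set) → ℕ → Set
IsLCM P m = (∀ l → P l → l ∣ m) × (∀ e → (∀ l → P l → l ∣ e) → m ∣ e)

module _ {n} (G : Digraph n) where

  Connected : Fin n → Fin n → Set
  Connected i j = Walk G i j × Walk G j i

  CycleLengthInComponentOf : Fin n → ℕ → Set
  CycleLengthInComponentOf i l =
    Σ[ c ∈ Cycle G ] Connected i (start c) × cycleLength c ≡ l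

  ComponentCyclicity : ℕ → Set
  ComponentCyclicity d =
    ∃[ i ] Node G i × IsGCD (CycleLengthInComponentOf i) d

  record HasCyclicity (γ : ℕ) : Set where
    field
      -- G is a disjoint union of strongly connected digraphs
      separated : ∀ {i j} → Edge G i j → Walk G j i
      lcm       : IsLCM ComponentCyclicity γ

------------------------------------------------------------------------
-- The digraph and the critical digraph of a matrix

associated : ∀ {n} → Matrix n → Digraph n
associated A = record
  { Node = λ _ → ⊤
  ; Edge = λ i j → A i j ≢ ε
  ; ends = λ _ → tt , tt
  }

finite : (a : ℝmax) → a ≢ ε → ℝ
finite ⊥₋    a≢ε = ⊥-elim (a≢ε refl)
finite [ x ] _   = x

module _ {n} (A : Matrix n) where

  weight : ∀ {i j} → Walk (associated A) i j → ℝ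
  weight done                = real (+ 0)
  weight (_◅_ {i} {j} a≢ε w) = finite (A i j) a≢ε +ᴿ weight w

  mean : Cycle (associated A) → ℝ
  mean c = weight (walk c) ÷ cycleLength c

  IsCritical : Cycle (associated A) → Set
  IsCritical c = ∀ c′ → mean c′ ≤ᴿ mean c

private
  target∈ : ∀ {n} {G : Digraph n} {i j k l} (w : Walk G i j) →
            (k , l) ∈ edges {G = G} w → l ≡ j ⊎ l ∈ sources {G = G} w
  target∈ (_ ◅ done)    (here refl) = inj₁ refl
  target∈ (_ ◅ _ ◅ _)   (here refl) = inj₂ (there (here refl))
  target∈ {G = G} (_ ◅ w) (there p) with target∈ {G = G} w p
  ... | inj₁ l≡j = inj₁ l≡j
  ... | inj₂ l∈w = inj₂ (there l∈w)

critical : ∀ {n} → Matrix n → Digraph n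
critical A = record
  { Node = λ i → Σ[ c ∈ Cycle (associated A) ] IsCritical A c × OnCycle c i
  ; Edge = λ i j → Σ[ c ∈ Cycle (associated A) ] IsCritical A c × EdgeOnCycle c (i , j)
  ; ends = λ (c , crit , p) →
      (c , crit , ∈-map⁺ proj₁ p) , (c , crit , target c p)
  }
  where
  target : ∀ c {i j} → EdgeOnCycle c (i , j) → OnCycle c j
  target c p with target∈ {G = associated A} (walk c) p
  ... | inj₁ refl = here refl
  ... | inj₂ j∈c  = j∈c

------------------------------------------------------------------------
-- CSR

IsPeriodicFrom : ∀ {n} → Matrix n → ℕ → ℕ → Set
IsPeriodicFrom S γ T = ∀ l → T ℕ.≤ l → S ^ (l ℕ.+ γ) ≈ᴹ S ^ l

-- The data entering the CSR property, for a family of matrices having a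
-- common critical digraph. Up to equivalence, 𝒜 determines all but t₀.
record CSRData {m n} (𝒜 : Fin m → Matrix n) : Set₁ where
  field
    𝒢           : Digraph n
    𝒢-critical  : ∀ s → critical (𝒜 s) ≈ᴳ 𝒢
    edge?       : ∀ i j → Dec (Edge 𝒢 i j)
    γ           : ℕ
    γ-cyclicity : HasCyclicity 𝒢 γ
    {{γ≢0}}     : NonZero γ

  S : Matrix n
  S i j = if does (edge? i j) then [ real (+ 0) ] else ε

  field
    T          : ℕ
    T-periodic : IsPeriodicFrom S γ T
    T-least    : ∀ T′ → IsPeriodicFrom S γ T′ → T ℕ.≤ T′
    t₀         : ℕ
    T≤t₀γ      : T ℕ.≤ t₀ ℕ.* γ

module _ {m n} {𝒜 : Fin m → Matrix n} (d : CSRData 𝒜) where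
  open CSRData d

  -- k is the number of factors of which Γ is a product.
  IsCSR : ℕ → Matrix n → Set
  IsCSR k Γ = Γ ≈ᴹ C ⊗ S ^ (k % γ) ⊗ R
    where
    C R : Matrix n
    C = Γ ⊗ S ^ ((t₀ ℕ.+ 1) ℕ.* γ ℕ.∸ k % γ)
    R = S ^ ((t₀ ℕ.+ 1) ℕ.* γ ℕ.∸ k % γ) ⊗ Γ

------------------------------------------------------------------------
-- The example

example : ℤ → Matrix 4
example a i j = lookup (lookup rows i) j
  where
  o h x : ℝmax
  o = [ real (+ 0) ]
  h = [ real (ℤ.- + 100) ]
  x = [ real a ]
  rows : Vec (Vec ℝmax 4) 4
  rows = (o ∷ x ∷ ε ∷ ε ∷ [])
       ∷ (ε ∷ o ∷ x ∷ ε ∷ [])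
       ∷ (ε ∷ ε ∷ o ∷ h ∷ [])
       ∷ (h ∷ ε ∷ ε ∷ ε ∷ [])
       ∷ []

A₁ A₂ : Matrix 4
A₁ = example (ℤ.- + 100)
A₂ = example (ℤ.- + 1)

𝒜 : Fin 2 → Matrix 4
𝒜 0F = A₁
𝒜 1F = A₂

-- Nodes are numbered from 0: the loops are at the first three nodes.
loops : Digraph 4
loops = record
  { Node = λ i → i ∈ 0F ∷ 1F ∷ 2F ∷ []
  ; Edge = λ i j → i ≡ j × i ∈ 0F ∷ 1F ∷ 2F ∷ []
  ; ends = λ { (refl , p) → p , p }
  }

{-# OPTIONS --safe #-}

-- Let Γ be a product of factors A₁ followed by a final A₂. A walk from node 0
-- to node 2 has to leave both 0 and 1, and only one of these two steps can be
-- the last, cheap one; hence Γ₀₂ ≤ -100. Staying at 0, respectively 1, until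
-- the last step shows Γ₀₁, Γ₁₂ ≥ -1. As node 1 is critical, the product
-- C ⊗ S ^ _ ⊗ R may go from 0 to 1 in the first copy of Γ, stay at 1 in the powers
-- of S and go from 1 to 2 in the second copy, so its entry at (0, 2) is ≥ -2.

module Submission where

open import Defs
open import Data.Bool.Base using (Bool; true; false; if_then_else_)
open import Data.Empty using (⊥; ⊥-elim)
open import Data.Fin.Base using (Fin; zero; suc)
open import Data.Fin.Patterns using (0F; 1F; 2F; 3F)
open import Data.Fin.Properties using (_≟_; all?)
open import Data.Integer.Base as ℤ using (+_)
open import Data.List.Base using ([]; _∷_)
open import Data.List.Membership.Propositional using (_∈_)
open import Data.List.Membership.Propositional.Properties using (∈-map⁻)
open import Data.List.Membership.DecPropositional using (_∈?_)
open import Data.List.Relation.Unary.All using ([])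
open import Data.List.Relation.Unary.AllPairs using ([]; _∷_)
open import Data.List.Relation.Unary.Any using (here; there)
open import Data.Nat.Base as ℕ using (ℕ; zero; suc; _+_; _≤_; z≤n; s≤s)
open import Data.Nat.DivMod using (_%_)
open import Data.Nat.Divisibility using (1∣_)
import Data.Nat.Properties as ℕ
import Data.Nat.Solver as ℕSolver
open import Data.Product using (_×_; Σ-syntax; ∃-syntax; _,_; proj₁; proj₂)
open import Data.Rational.Base as ℚ using (ℚ; 0ℚ; 1ℚ)
open import Data.Rational.Literals using (fromℤ)
import Data.Rational.Properties as ℚ
open import Data.Rational.Unnormalised.Base as ℚᵘ using (mkℚᵘ)
import Data.Rational.Unnormalised.Properties as ℚᵘ
open import Data.Unit.Base using (⊤; tt)
open import Data.Vec.Base using (Vec; map; replicate; _∷ʳ_)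
import Data.Vec.Functional as Vector
open import Function.Base using (id; _∘_)
open import Function.Bundles using (_⇔_; mk⇔; Equivalence)
open import Relation.Binary.Construct.Closure.ReflexiveTransitive
  using (_◅_; _◅◅_) renaming (ε to done)
open import Relation.Binary.Construct.Add.Infimum.Equality _≈ᴿ_
  using (⊥₋≈⊥₋; [_])
open import Relation.Binary.PropositionalEquality
open import Relation.Nullary.Construct.Add.Infimum using (⊥₋; [_])
open import Relation.Nullary.Decidable
  using (Dec; yes; no; does; from-yes; from-no; ¬?; _×-dec_; _→-dec_)
open import Relation.Nullary.Negation.Core using (¬_; contradiction)

-- Bounds on elements of ℝmax

-- Bounds hold for every approximation, not merely up to ≈ᴿ.
AtLeast AtMost : ℚ → ℝmax → Set
AtLeast p ⊥₋    = ⊥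
AtLeast p [ x ] = ∀ n → p ℚ.≤ seq x n
AtMost p ⊥₋     = ⊤
AtMost p [ x ]  = ∀ n → seq x n ℚ.≤ p

atLeast⇒≢ε : ∀ {p} a → AtLeast p a → a ≢ ε
atLeast⇒≢ε [ x ] _ ()

atMost-mono : ∀ {p q} → p ℚ.≤ q → ∀ a → AtMost p a → AtMost q a
atMost-mono p≤q ⊥₋    _   = tt
atMost-mono p≤q [ x ] x≤p = λ n → ℚ.≤-trans (x≤p n) p≤q

atLeast-⊕ˡ : ∀ {p} a b → AtLeast p a → AtLeast p (a ⊕ b)
atLeast-⊕ˡ [ x ] ⊥₋    p≤x = p≤x
atLeast-⊕ˡ [ x ] [ y ] p≤x = λ n → ℚ.≤-trans (p≤x n) (ℚ.p≤p⊔q (seq x n) (seq y n))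

atLeast-⊕ʳ : ∀ {p} a b → AtLeast p b → AtLeast p (a ⊕ b)
atLeast-⊕ʳ ⊥₋    b     p≤b = p≤b
atLeast-⊕ʳ [ x ] [ y ] p≤y = λ n → ℚ.≤-trans (p≤y n) (ℚ.p≤q⊔p (seq x n) (seq y n))

atMost-⊕ : ∀ {p} a b → AtMost p a → AtMost p b → AtMost p (a ⊕ b)
atMost-⊕ ⊥₋    b     _   b≤p = b≤p
atMost-⊕ [ x ] ⊥₋    x≤p _   = x≤p
atMost-⊕ [ x ] [ y ] x≤p y≤p = λ n → ℚ.⊔-lub (x≤p n) (y≤p n)

atLeast-⊙ : ∀ {p q} a b → AtLeast p a → AtLeast q b → AtLeast (p ℚ.+ q) (a ⊙ b)
atLeast-⊙ [ x ] [ y ] p≤x q≤y =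
  λ n → ℚ.+-mono-≤ (p≤x (double n)) (q≤y (double n))

atMost-⊙ : ∀ {p q} a b → AtMost p a → AtMost q b → AtMost (p ℚ.+ q) (a ⊙ b)
atMost-⊙ ⊥₋    _     _   _   = tt
atMost-⊙ [ x ] ⊥₋    _   _   = tt
atMost-⊙ [ x ] [ y ] x≤p y≤q =
  λ n → ℚ.+-mono-≤ (x≤p (double n)) (y≤q (double n))

atLeast-foldr : ∀ {p n} (f : Vector.Vector ℝmax n) l → AtLeast p (f l) →
                AtLeast p (Vector.foldr _⊕_ ε f)
atLeast-foldr f zero    p≤f = atLeast-⊕ˡ (f zero) _ p≤f
atLeast-foldr f (suc l) p≤f = atLeast-⊕ʳ (f zero) _ (atLeast-foldr (f ∘ suc) l p≤f)

atMost-foldr : ∀ {p n} (f : Vector.Vector ℝmax n) → (∀ l → AtMost p (f l)) →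
               AtMost p (Vector.foldr _⊕_ ε f)
atMost-foldr {n = zero}  f f≤p = tt
atMost-foldr {n = suc n} f f≤p =
  atMost-⊕ (f zero) _ (f≤p zero) (atMost-foldr (f ∘ suc) (f≤p ∘ suc))

-- Bounds on entries of matrix products and powers

atLeast-⊗ : ∀ {p q n} (A B : Matrix n) {i l j} →
            AtLeast p (A i l) → AtLeast q (B l j) → AtLeast (p ℚ.+ q) ((A ⊗ B) i j)
atLeast-⊗ A B {i} {l} {j} p≤A q≤B =
  atLeast-foldr (λ l → A i l ⊙ B l j) l (atLeast-⊙ (A i l) (B l j) p≤A q≤B)

-- The walk that stays at `i` throughout has weight at least 0.
atLeast-^ : ∀ {n} (A : Matrix n) {i} → AtLeast 0ℚ (A i i) →
            ∀ k → AtLeast 0ℚ ((A ^ k) i i)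
atLeast-^ A {i} 0≤A zero with i ≟ i
... | yes _   = λ _ → ℚ.≤-refl
-- Here the entry has become `ε`, so the goal is `⊥`.
... | no  i≢i = i≢i refl
atLeast-^ A 0≤A (suc k) = atLeast-⊗ A (A ^ k) 0≤A (atLeast-^ A 0≤A k)

NonPositive : ∀ {n} → Matrix n → Set
NonPositive A = ∀ i j → AtMost 0ℚ (A i j)

nonPositive-I : ∀ {n} → NonPositive (I {n})
nonPositive-I i j with does (i ≟ j)
... | true  = λ _ → ℚ.≤-refl
... | false = tt

nonPositive-⊗ : ∀ {n} {A B : Matrix n} →
                NonPositive A → NonPositive B → NonPositive (A ⊗ B)
nonPositive-⊗ {A = A} {B} A≤0 B≤0 i j =
  atMost-foldr _ λ l → atMost-⊙ (A i l) (B l j) (A≤0 i l) (B≤0 l j)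

-- Digraphs

edge∈ : ∀ {n} (G : Digraph n) {i j k l} (w : Walk G i j) →
        (k , l) ∈ edges {G = G} w → Edge G k l
edge∈ G (e ◅ w) (here refl) = e
edge∈ G (e ◅ w) (there p)   = edge∈ G w p

loop : ∀ {n} {G : Digraph n} {i} → Edge G i i → Cycle G
loop e = record { first = e ; rest = done ; elementary = [] ∷ [] }

-- A loop is a cycle of length 1, so the cyclicity of a component containing one divides 1.
hasCyclicity-1 : ∀ {n} {G : Digraph n} →
                 (∀ {i j} → Edge G i j → Walk G j i) →
                 (∀ {i} → Node G i → ∃[ j ] Connected G i j × Edge G j j) →
                 HasCyclicity G 1
hasCyclicity-1 separated loopConnected = record
  { separated = separated
  ; lcm = (λ { d (i , i∈G , d∣ , _) → let (j , i~j , e) = loopConnected i∈G in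
                 d∣ 1 (loop e , i~j , refl) })
        , λ m _ → 1∣ m
  }

-- The ring 0 → 1 → 2 → 3 → 0 visits every node, so any two nodes are joined through 0.
ring-connected : ∀ {G : Digraph 4} → Edge G 0F 1F → Edge G 1F 2F →
                 Edge G 2F 3F → Edge G 3F 0F → ∀ i j → Walk G i j
ring-connected {G} e₀₁ e₁₂ e₂₃ e₃₀ i j = toZero i ◅◅ fromZero j
  where
  toZero : ∀ i → Walk G i 0F
  toZero 0F = done
  toZero 1F = e₁₂ ◅ e₂₃ ◅ e₃₀ ◅ done
  toZero 2F = e₂₃ ◅ e₃₀ ◅ done
  toZero 3F = e₃₀ ◅ done

  fromZero : ∀ i → Walk G 0F i
  fromZero 0F = done
  fromZero 1F = e₀₁ ◅ done
  fromZero 2F = e₀₁ ◅ e₁₂ ◅ done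
  fromZero 3F = e₀₁ ◅ e₁₂ ◅ e₂₃ ◅ done

≈loops⇒hasCyclicity-1 : ∀ {G} → G ≈ᴳ loops → HasCyclicity G 1
≈loops⇒hasCyclicity-1 {G} (nodes , edges) = hasCyclicity-1
  (λ e → backwards (Equivalence.to (edges _ _) e))
  (λ {i} i∈G → i , (done , done) ,
    Equivalence.from (edges i i) (refl , Equivalence.to (nodes i) i∈G))
  where
  backwards : ∀ {i j} → Edge loops i j → Walk G j i
  backwards (refl , _) = done

-- Critical cycles of a nonpositive matrix

0≤δ+δ : ∀ n → 0ℚ ℚ.≤ δ n ℚ.+ δ n
0≤δ+δ n = ℚ.+-mono-≤ 0≤δ 0≤δ
  where
  0≤δ : 0ℚ ℚ.≤ δ n
  0≤δ = ℚ.nonNegative⁻¹ (δ n) {{ℚ.normalize-nonNeg 1 (suc n)}}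

-- The left side is 2/(2k + 4) = 1/(k + 2), so the slack of a comparison of reals at index `m` stays
-- below 1/(k + 1).
δ+δ<δ : ∀ k → let m = double (suc k) in δ m ℚ.+ δ m ℚ.< δ k
δ+δ<δ k = ℚ.toℚᵘ-cancel-< (begin-strict
  ℚ.toℚᵘ (δ m ℚ.+ δ m)              ≃⟨ ℚ.toℚᵘ-homo-+ (δ m) (δ m) ⟩
  ℚ.toℚᵘ (δ m) ℚᵘ.+ ℚ.toℚᵘ (δ m)    ≃⟨ ℚᵘ.+-cong (δ≃ m) (δ≃ m) ⟩
  mkℚᵘ (+ 1) m ℚᵘ.+ mkℚᵘ (+ 1) m    <⟨ ℚᵘ.*<* (ℤ.+<+ crossMultiplied) ⟩
  mkℚᵘ (+ 1) k                      ≃⟨ ℚᵘ.≃-sym (δ≃ k) ⟩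
  ℚ.toℚᵘ (δ k)                      ∎)
  where
  open ℚᵘ.≤-Reasoning
  m : ℕ
  m = double (suc k)
  δ≃ : ∀ n → ℚ.toℚᵘ (δ n) ℚᵘ.≃ mkℚᵘ (+ 1) n
  δ≃ n = ℚ.toℚᵘ-fromℚᵘ (mkℚᵘ (+ 1) n)
  crossMultiplied : (1 ℕ.* suc m ℕ.+ 1 ℕ.* suc m) ℕ.* suc k
                    ℕ.< 1 ℕ.* (suc m ℕ.* suc m)
  crossMultiplied = subst₂ ℕ._<_
    (solve 2 (λ m k → m :* (k :+ k) := (con 1 :* m :+ con 1 :* m) :* k) refl
      (suc m) (suc k))
    (sym (ℕ.*-identityˡ (suc m ℕ.* suc m)))
    (ℕ.*-monoʳ-< (suc m) (ℕ.m≤n+m (suc (suc k ℕ.+ suc k)) 1))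
    where open ℕSolver.+-*-Solver

critical-node⇒edge : ∀ {n} (A : Matrix n) {i} →
                     Node (critical A) i → ∃[ j ] Edge (critical A) i j
critical-node⇒edge A (c , c-critical , i∈c) with ∈-map⁻ proj₁ i∈c
... | (_ , j) , e∈c , refl = j , c , c-critical , e∈c

-1ℚ : ℚ
-1ℚ = ℚ.- 1ℚ

finite-atLeast : ∀ {p} a (a≢ε : a ≢ ε) → AtLeast p a → ∀ n → p ℚ.≤ seq (finite a a≢ε) n
finite-atLeast [ x ] _ p≤x = p≤x

finite-atMost : ∀ {p} a (a≢ε : a ≢ ε) → AtMost p a → ∀ n → seq (finite a a≢ε) n ℚ.≤ p
finite-atMost ⊥₋    a≢ε _   = ⊥-elim (a≢ε refl)
finite-atMost [ x ] _   x≤p = x≤p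

module _ {n} {A : Matrix n} (A≤0 : NonPositive A) where

  private
    G : Digraph n
    G = associated A

  weight≤0 : ∀ {i j} (w : Walk G i j) n → seq (weight A w) n ℚ.≤ 0ℚ
  weight≤0 done                n = ℚ.≤-refl
  weight≤0 (_◅_ {i} {j} a≢ε w) n = ℚ.+-mono-≤
    (finite-atMost (A i j) a≢ε (A≤0 i j) (double n)) (weight≤0 w (double n))

  -- The other edges of the walk contribute nothing positive.
  weight≤edge : ∀ {p i j k l} (w : Walk G i j) → (k , l) ∈ edges {G = G} w →
                AtMost p (A k l) → ∀ n → seq (weight A w) n ℚ.≤ p
  weight≤edge {p} {k = k} {l} (a≢ε ◅ w) (here refl) A≤p n =
    subst (_ ℚ.≤_) (ℚ.+-identityʳ p) (ℚ.+-mono-≤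
      (finite-atMost (A k l) a≢ε A≤p (double n)) (weight≤0 w (double n)))
  weight≤edge {p} (_◅_ {i} {j} a≢ε w) (there e∈w) A≤p n =
    subst (_ ℚ.≤_) (ℚ.+-identityˡ p) (ℚ.+-mono-≤
      (finite-atMost (A i j) a≢ε (A≤0 i j) (double n))
      (weight≤edge w e∈w A≤p (double n)))

  mean-mono : ∀ {p} (c : Cycle G) n → seq (weight A (walk c)) n ℚ.≤ p →
              seq (mean A c) n ℚ.≤ p ℚ.* (+ 1 ℚ./ cycleLength c)
  mean-mono c n = ℚ.*-monoʳ-≤-nonNeg _ {{ℚ.normalize-nonNeg 1 (cycleLength c)}}

  0≤mean-loop : ∀ {i} (a≢ε : A i i ≢ ε) → AtLeast 0ℚ (A i i) →
                ∀ n → 0ℚ ℚ.≤ seq (mean A (loop a≢ε)) n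
  -- The loop has length 1, so taking the mean multiplies by `1ℚ`.
  0≤mean-loop {i} a≢ε 0≤A n = ℚ.*-monoʳ-≤-nonNeg 1ℚ
    (ℚ.+-mono-≤ (finite-atLeast (A i i) a≢ε 0≤A (double n)) ℚ.≤-refl)

  -- Without positive entries no cycle has mean above 0, a value that this loop attains.
  loop-critical : ∀ {i} (a≢ε : A i i ≢ ε) → AtLeast 0ℚ (A i i) →
                  IsCritical A (loop a≢ε)
  loop-critical a≢ε 0≤A c n = begin
    seq (mean A c) n                              ≤⟨ mean-mono c n (weight≤0 (walk c) n) ⟩
    0ℚ ℚ.* (+ 1 ℚ./ cycleLength c)                ≡⟨ ℚ.*-zeroˡ (+ 1 ℚ./ cycleLength c) ⟩
    0ℚ                                            ≤⟨ ℚ.+-mono-≤ (0≤mean-loop a≢ε 0≤A n) (0≤δ+δ n) ⟩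
    seq (mean A (loop a≢ε)) n ℚ.+ (δ n ℚ.+ δ n)   ∎
    where open ℚ.≤-Reasoning

  loop-critical-edge : ∀ i → AtLeast 0ℚ (A i i) → Edge (critical A) i i
  loop-critical-edge i 0≤A =
    let a≢ε = atLeast⇒≢ε (A i i) 0≤A in
    loop a≢ε , loop-critical a≢ε 0≤A , here refl

  -- An edge of weight at most -1 makes the mean of a cycle of length k + 1 at
  -- most -1/(k + 1), which is visible at precision 1/(2k + 4).
  critical-edge : ∀ {i} → AtLeast 0ℚ (A i i) → ∀ c → IsCritical A c →
                  ∀ {k l} → EdgeOnCycle c (k , l) → ¬ AtMost -1ℚ (A k l)
  critical-edge {i} 0≤A c critical e∈c A≤-1 = ℚ.<-irrefl refl (begin-strict
    0ℚ                                    ≤⟨ 0≤mean-loop a≢ε 0≤A m ⟩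
    seq (mean A (loop a≢ε)) m             ≤⟨ critical (loop a≢ε) m ⟩
    seq (mean A c) m ℚ.+ (δ m ℚ.+ δ m)    <⟨ ℚ.+-mono-≤-< mean≤ (δ+δ<δ k) ⟩
    -1ℚ ℚ.* δ k ℚ.+ δ k                   ≡⟨ cong (ℚ._+ δ k) (ℚ.neg-distribˡ-* 1ℚ (δ k)) ⟨
    ℚ.- (1ℚ ℚ.* δ k) ℚ.+ δ k              ≡⟨ cong (λ q → ℚ.- q ℚ.+ δ k) (ℚ.*-identityˡ (δ k)) ⟩
    ℚ.- δ k ℚ.+ δ k                       ≡⟨ ℚ.+-inverseˡ (δ k) ⟩
    0ℚ                                    ∎)
    where
    open ℚ.≤-Reasoning
    a≢ε : A i i ≢ ε
    a≢ε = atLeast⇒≢ε (A i i) 0≤A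
    k m : ℕ
    k = length {G = G} (rest c)
    m = double (suc k)
    mean≤ : seq (mean A c) m ℚ.≤ -1ℚ ℚ.* δ k
    mean≤ = mean-mono c m (weight≤edge (walk c) e∈c A≤-1 m)

-- Unlike a `with` on i ≟ j at the place of use, this does not normalise the
-- entries of `example`, which contain large proofs of regularity.
byEquality : ∀ {n} {P : Fin n → Fin n → Set} → (∀ i → P i i) →
             (∀ i j → i ≢ j → P i j) → ∀ i j → P i j
byEquality equal unequal i j with i ≟ j
... | yes refl = equal i
... | no  i≢j  = unequal i j i≢j

-- The loop at node 0 has mean 0. A cycle using an edge between distinct nodes has negative mean and
-- cannot be critical, which leaves the loops; those present all have weight 0.
critical≈loops : ∀ {A : Matrix 4} → NonPositive A →
                 (∀ i j → i ≢ j → AtMost -1ℚ (A i j)) →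
                 (∀ i → i ∈ 0F ∷ 1F ∷ 2F ∷ [] → AtLeast 0ℚ (A i i)) →
                 (∀ i → A i i ≢ ε → i ∈ 0F ∷ 1F ∷ 2F ∷ []) →
                 critical A ≈ᴳ loops
critical≈loops {A} A≤0 offDiagonal diagonal loop∈ =
  nodes , λ i j → mk⇔ (edge⁺ i j) edge⁻
  where
  edge⁺ : ∀ i j → Edge (critical A) i j → Edge loops i j
  edge⁺ = byEquality
    (λ i (c , _ , e∈c) → refl , loop∈ i (edge∈ (associated A) (walk c) e∈c))
    (λ i j i≢j (c , c-critical , e∈c) → ⊥-elim
      (critical-edge A≤0 (diagonal 0F (here refl)) c c-critical e∈c (offDiagonal i j i≢j)))

  edge⁻ : ∀ {i j} → Edge loops i j → Edge (critical A) i j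
  edge⁻ {i} (refl , i∈) = loop-critical-edge A≤0 i (diagonal i i∈)

  nodes : ∀ i → Node (critical A) i ⇔ Node loops i
  nodes i = mk⇔
    (λ i∈G → let (j , e) = critical-node⇒edge A i∈G in proj₂ (edge⁺ i j e))
    (λ i∈ → proj₁ (ends (critical A) (edge⁻ (refl , i∈))))

-- The example

-100ℚ -2ℚ : ℚ
-100ℚ = fromℤ (ℤ.- + 100)
-2ℚ   = fromℤ (ℤ.- + 2)

ε? : ∀ a → Dec (a ≡ ε)
ε? ⊥₋    = yes refl
ε? [ _ ] = no λ ()

-- Which entries are `ε` is independent of the parameter, so the decision procedure evaluates with
-- `a` and `b` left as variables.
example-support : ∀ a b i j → example a i j ≢ ε → example b i j ≢ ε
example-support a b = from-yes (all? λ i → all? λ j →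
  ¬? (ε? (example a i j)) →-dec ¬? (ε? (example b i j)))

example-diagonal : ∀ a {i} → i ∈ 0F ∷ 1F ∷ 2F ∷ [] → AtLeast 0ℚ (example a i i)
example-diagonal a (here refl)                 _ = ℚ.≤-refl
example-diagonal a (there (here refl))         _ = ℚ.≤-refl
example-diagonal a (there (there (here refl))) _ = ℚ.≤-refl

example-loop : ∀ a {i} → example a i i ≢ ε → i ∈ 0F ∷ 1F ∷ 2F ∷ []
example-loop a {0F} _   = here refl
example-loop a {1F} _   = there (here refl)
example-loop a {2F} _   = there (there (here refl))
example-loop a {3F} a≢ε = contradiction refl a≢ε

module _ {a} (-100≤a : -100ℚ ℚ.≤ fromℤ a) where

  -- The off-diagonal entries are `ε`, `a` or -100, and -100 is covered by the assumption on `a`.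
  example-offDiagonal : ∀ i j → i ≢ j → AtMost (fromℤ a) (example a i j)
  example-offDiagonal 0F 0F i≢j = contradiction refl i≢j
  example-offDiagonal 0F 1F _   = λ _ → ℚ.≤-refl
  example-offDiagonal 0F 2F _   = tt
  example-offDiagonal 0F 3F _   = tt
  example-offDiagonal 1F 0F _   = tt
  example-offDiagonal 1F 1F i≢j = contradiction refl i≢j
  example-offDiagonal 1F 2F _   = λ _ → ℚ.≤-refl
  example-offDiagonal 1F 3F _   = tt
  example-offDiagonal 2F 0F _   = tt
  example-offDiagonal 2F 1F _   = tt
  example-offDiagonal 2F 2F i≢j = contradiction refl i≢j
  example-offDiagonal 2F 3F _   = λ _ → -100≤a
  example-offDiagonal 3F 0F _   = λ _ → -100≤a
  example-offDiagonal 3F 1F _   = tt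
  example-offDiagonal 3F 2F _   = tt
  example-offDiagonal 3F 3F i≢j = contradiction refl i≢j

  module _ (a≤-1 : fromℤ a ℚ.≤ -1ℚ) where

    example-offDiagonal≤-1 : ∀ i j → i ≢ j → AtMost -1ℚ (example a i j)
    example-offDiagonal≤-1 i j i≢j =
      atMost-mono a≤-1 (example a i j) (example-offDiagonal i j i≢j)

    example-nonPositive : NonPositive (example a)
    example-nonPositive = byEquality diagonal λ i j i≢j →
      atMost-mono (from-yes (-1ℚ ℚ.≤? 0ℚ)) (example a i j) (example-offDiagonal≤-1 i j i≢j)
      where
      diagonal : ∀ i → AtMost 0ℚ (example a i i)
      diagonal 0F = λ _ → ℚ.≤-refl
      diagonal 1F = λ _ → ℚ.≤-refl
      diagonal 2F = λ _ → ℚ.≤-refl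
      diagonal 3F = tt

    critical-example : critical (example a) ≈ᴳ loops
    critical-example = critical≈loops example-nonPositive example-offDiagonal≤-1
      (λ i → example-diagonal a {i}) (λ i → example-loop a {i})

-- The ring makes the digraph strongly connected, and there is a loop at node 0.
associated-hasCyclicity : ∀ a → HasCyclicity (associated (example a)) 1
associated-hasCyclicity a = hasCyclicity-1
  (λ {i} {j} _ → connect j i)
  (λ {i} _ → 0F , (connect i 0F , connect 0F i) , λ ())
  where
  connect : ∀ i j → Walk (associated (example a)) i j
  connect = ring-connected {associated (example a)} (λ ()) (λ ()) (λ ()) (λ ())

critical-𝒜 : ∀ s → critical (𝒜 s) ≈ᴳ loops
critical-𝒜 0F = critical-example ℚ.≤-refl (from-yes (-100ℚ ℚ.≤? -1ℚ))
critical-𝒜 1F = critical-example (from-yes (-100ℚ ℚ.≤? -1ℚ)) ℚ.≤-refl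

associated-𝒜-hasCyclicity : ∀ s → HasCyclicity (associated (𝒜 s)) 1
associated-𝒜-hasCyclicity 0F = associated-hasCyclicity _
associated-𝒜-hasCyclicity 1F = associated-hasCyclicity _

-- The data of the CSR decomposition

loop? : ∀ i j → Dec (Edge loops i j)
loop? i j = (i ≟ j) ×-dec _∈?_ _≟_ i (0F ∷ 1F ∷ 2F ∷ [])

loopMatrix : Matrix 4
loopMatrix i j = if does (loop? i j) then [ real (+ 0) ] else ε

-- With `does (i ≟ j)` as the Boolean, this describes an entry of the identity matrix. Each `+ᴿ`
-- builds a new sequence, so a zero entry of a power is known only by its approximations.
ZeroIf : Bool → ℝmax → Set
ZeroIf true  [ x ] = ∀ n → seq x n ≡ 0ℚ
ZeroIf true  ⊥₋    = ⊥
ZeroIf false a     = a ≡ ε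

zeroIf-≈ : ∀ b {x y} → ZeroIf b x → ZeroIf b y → x ≈₋ y
zeroIf-≈ true  {[ x ]} {[ y ]} x≡0 y≡0 = [ ≤ x y x≡0 y≡0 , ≤ y x y≡0 x≡0 ]
  where
  ≤ : ∀ x y → (∀ n → seq x n ≡ 0ℚ) → (∀ n → seq y n ≡ 0ℚ) → x ≤ᴿ y
  ≤ x y x≡0 y≡0 n = subst₂ (λ p q → p ℚ.≤ q ℚ.+ (δ n ℚ.+ δ n)) (sym (x≡0 n)) (sym (y≡0 n))
    (ℚ.+-monoʳ-≤ 0ℚ (0≤δ+δ n))
zeroIf-≈ false refl refl = ⊥₋≈⊥₋

-- In a product with `loopMatrix` on the left, each of the first three rows has a single term that
-- is not `ε` by computation; the expression here is what remains of the sum.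
zeroIf-0⊙⊕ε : ∀ b a → ZeroIf b a → ZeroIf b ([ real (+ 0) ] ⊙ a ⊕ ε)
zeroIf-0⊙⊕ε true  [ x ] x≡0  n = cong (0ℚ ℚ.+_) (x≡0 (double n))
zeroIf-0⊙⊕ε false .ε    refl   = refl

loopMatrix^-row : ∀ k {i} j → i ≢ 3F → ZeroIf (does (i ≟ j)) ((loopMatrix ^ k) i j)
loopMatrix^-row zero {i} j _ with does (i ≟ j)
... | true  = λ _ → refl
... | false = refl
loopMatrix^-row (suc k) {0F} j i≢3 = zeroIf-0⊙⊕ε (does (0F ≟ j)) _ (loopMatrix^-row k j i≢3)
loopMatrix^-row (suc k) {1F} j i≢3 = zeroIf-0⊙⊕ε (does (1F ≟ j)) _ (loopMatrix^-row k j i≢3)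
loopMatrix^-row (suc k) {2F} j i≢3 = zeroIf-0⊙⊕ε (does (2F ≟ j)) _ (loopMatrix^-row k j i≢3)
loopMatrix^-row (suc k) {3F} j i≢3 = contradiction refl i≢3

-- From exponent 1 on, the powers have the first three rows of the identity, while row 3 is `ε`
-- because node 3 has no loop.
loopMatrix-periodic : IsPeriodicFrom loopMatrix 1 1
loopMatrix-periodic (suc l) _ = λ where
    0F j → row 0F j λ ()
    1F j → row 1F j λ ()
    2F j → row 2F j λ ()
    3F j → ⊥₋≈⊥₋
  where
  row : ∀ i j → i ≢ 3F → (loopMatrix ^ (suc l + 1)) i j ≈₋ (loopMatrix ^ suc l) i j
  row i j i≢3 = zeroIf-≈ (does (i ≟ j))
    (loopMatrix^-row (suc l + 1) j i≢3) (loopMatrix^-row (suc l) j i≢3)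

-- The power with exponent 0 is `I`, whose entry at (3, 3) is 0, whereas that of `loopMatrix` is
-- `ε`.
loopMatrix-aperiodic : ¬ IsPeriodicFrom loopMatrix 1 0
loopMatrix-aperiodic periodic with () ← periodic 0 z≤n 3F 3F

-- This shows that the claims quantified over all `CSRData 𝒜` are not vacuous.
csrData : CSRData 𝒜
csrData = record
  { 𝒢           = loops
  ; 𝒢-critical  = critical-𝒜
  ; edge?       = loop?
  ; γ           = 1
  ; γ-cyclicity = ≈loops⇒hasCyclicity-1 ((λ _ → mk⇔ id id) , (λ _ _ → mk⇔ id id))
  ; T           = 1
  ; T-periodic  = loopMatrix-periodic
  ; T-least     = λ { zero    periodic → contradiction periodic loopMatrix-aperiodic
                    ; (suc _) _        → s≤s z≤n }
  ; t₀          = 1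
  ; T≤t₀γ       = ℕ.≤-refl
  }

-- Products of factors A₁ followed by a final A₂

-- The invariant of the powers of `A₁`, carried by induction on the exponent.
record Slow (M : Matrix 4) : Set where
  field
    nonPositive : NonPositive M
    leave₀      : ∀ j → AtMost -100ℚ (M 0F (suc j))
    stay₀       : AtLeast 0ℚ (M 0F 0F)
    stay₁       : AtLeast 0ℚ (M 1F 1F)

-- The invariant once `A₂` is the last factor: either step alone is cheap, but the two together are
-- not.
record Fast (M : Matrix 4) : Set where
  field
    nonPositive : NonPositive M
    step₀₁      : AtLeast -1ℚ (M 0F 1F)
    step₁₂      : AtLeast -1ℚ (M 1F 2F)
    steps₀₂     : AtMost -100ℚ (M 0F 2F)

slow-I : Slow I
slow-I = record
  { nonPositive = nonPositive-I
  ; leave₀      = λ _ → tt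
  ; stay₀       = λ _ → ℚ.≤-refl
  ; stay₁       = λ _ → ℚ.≤-refl
  }

slow-A₁ : Slow A₁
slow-A₁ = record
  { nonPositive = example-nonPositive ℚ.≤-refl (from-yes (-100ℚ ℚ.≤? -1ℚ))
  ; leave₀      = λ j → example-offDiagonal ℚ.≤-refl 0F (suc j) λ ()
  ; stay₀       = λ _ → ℚ.≤-refl
  ; stay₁       = λ _ → ℚ.≤-refl
  }

fast-A₂ : Fast A₂
fast-A₂ = record
  { nonPositive = example-nonPositive (from-yes (-100ℚ ℚ.≤? -1ℚ)) ℚ.≤-refl
  ; step₀₁      = λ _ → ℚ.≤-refl
  ; step₁₂      = λ _ → ℚ.≤-refl
  ; steps₀₂     = tt
  }

-- The base case for words, since `product` closes with a factor `I`.
fast-A₂⊗I : Fast (A₂ ⊗ I)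
fast-A₂⊗I = record
  { nonPositive = nonPositive-⊗ (Fast.nonPositive fast-A₂) nonPositive-I
  ; step₀₁      = λ _ → ℚ.≤-refl
  ; step₁₂      = λ _ → ℚ.≤-refl
  ; steps₀₂     = tt
  }

module _ {M N : Matrix 4} (M-slow : Slow M) where

  private module M = Slow M-slow

  -- A walk through M from 0 either is back at 0 at the end or costs 100.
  slow-⊗-atMost : NonPositive N → ∀ j → AtMost -100ℚ (N 0F j) →
                  AtMost -100ℚ ((M ⊗ N) 0F j)
  slow-⊗-atMost N≤0 j N≤-100 = atMost-foldr (λ l → M 0F l ⊙ N l j) λ where
    zero    → atMost-⊙ {0ℚ} (M 0F 0F) (N 0F j) (M.nonPositive 0F 0F) N≤-100
    (suc l) → atMost-⊙ { -100ℚ} (M 0F (suc l)) (N (suc l) j) (M.leave₀ l) (N≤0 (suc l) j)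

  slow-⊗-slow : Slow N → Slow (M ⊗ N)
  slow-⊗-slow N-slow = record
    { nonPositive = nonPositive-⊗ M.nonPositive N.nonPositive
    ; leave₀      = λ j → slow-⊗-atMost N.nonPositive (suc j) (N.leave₀ j)
    ; stay₀       = atLeast-⊗ M N M.stay₀ N.stay₀
    ; stay₁       = atLeast-⊗ M N M.stay₁ N.stay₁
    }
    where module N = Slow N-slow

  slow-⊗-fast : Fast N → Fast (M ⊗ N)
  slow-⊗-fast N-fast = record
    { nonPositive = nonPositive-⊗ M.nonPositive N.nonPositive
    ; step₀₁      = atLeast-⊗ M N M.stay₀ N.step₀₁
    ; step₁₂      = atLeast-⊗ M N M.stay₁ N.step₁₂
    ; steps₀₂     = slow-⊗-atMost N.nonPositive 2F N.steps₀₂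
    }
    where module N = Fast N-fast

slow-A₁^ : ∀ t → Slow (A₁ ^ t)
slow-A₁^ zero    = slow-I
slow-A₁^ (suc t) = slow-⊗-slow slow-A₁ (slow-A₁^ t)

word : ∀ N → Vec (Fin 2) (suc N)
word N = replicate N 0F ∷ʳ 1F

-- `product` brackets to the right, unlike `A₁ ^ t ⊗ A₂`; carrying the invariant along the word
-- avoids any appeal to associativity.
fast-word : ∀ N → Fast (product (map 𝒜 (word N)))
fast-word zero    = fast-A₂⊗I
fast-word (suc N) = slow-⊗-fast slow-A₁ (fast-word N)

-- Failure of the CSR property

-- Index 0 is already precise enough: the slack there is 2, and -100 + 2 is below -2.
atLeast⇒¬≈atMost : ∀ a b → AtMost -100ℚ a → AtLeast -2ℚ b → ¬ a ≈₋ b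
atLeast⇒¬≈atMost [ x ] [ y ] x≤-100 -2≤y [ _ , y≤x ] =
  from-no (-2ℚ ℚ.≤? -100ℚ ℚ.+ (δ 0 ℚ.+ δ 0)) (begin
    -2ℚ                            ≤⟨ -2≤y 0 ⟩
    seq y 0                        ≤⟨ y≤x 0 ⟩
    seq x 0 ℚ.+ (δ 0 ℚ.+ δ 0)      ≤⟨ ℚ.+-monoˡ-≤ (δ 0 ℚ.+ δ 0) (x≤-100 0) ⟩
    -100ℚ ℚ.+ (δ 0 ℚ.+ δ 0)        ∎)
  where open ℚ.≤-Reasoning

fast⇒¬CSR : ∀ (d : CSRData 𝒜) k {Γ} → Fast Γ → ¬ IsCSR d k Γ
fast⇒¬CSR d k {Γ} Γ-fast csr = atLeast⇒¬≈atMost _ _ steps₀₂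
  -- The walk 0 → 1 → 1 → 1 → 1 → 2 through the factors `Γ`, `S ^ e`, `S ^ (k % γ)`, `S ^ e`, `Γ`.
  -- Its bounds -1, 0, 0, 0, -1 add up to `-2ℚ` by computation.
  (atLeast-⊗ (C ⊗ S ^ (k % γ)) R
    (atLeast-⊗ C (S ^ (k % γ))
      (atLeast-⊗ Γ (S ^ e) step₀₁ (stay e))
      (stay (k % γ)))
    (atLeast-⊗ (S ^ e) Γ (stay e) step₁₂))
  (csr 0F 2F)
  where
  open CSRData d
  open Fast Γ-fast
  e : ℕ
  e = (t₀ ℕ.+ 1) ℕ.* γ ℕ.∸ k % γ
  C R : Matrix 4
  C = Γ ⊗ S ^ e
  R = S ^ e ⊗ Γ

  loop₁ : Edge 𝒢 1F 1F
  -- `𝒢` comes with the arbitrary data `d`; the loop reaches it from `loops` by way of the critical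
  -- digraph of `A₁`.
  loop₁ = Equivalence.to (proj₂ (𝒢-critical 0F) 1F 1F)
    (Equivalence.from (proj₂ (critical-𝒜 0F) 1F 1F) (refl , there (here refl)))

  stay₁ : AtLeast 0ℚ (S 1F 1F)
  stay₁ with edge? 1F 1F
  ... | yes _       = λ _ → ℚ.≤-refl
  ... | no  no-loop = no-loop loop₁

  stay : ∀ l → AtLeast 0ℚ ((S ^ l) 1F 1F)
  stay = atLeast-^ S stay₁

mainTheorem6 : (∀ s → critical (𝒜 s) ≈ᴳ loops)
    × (∀ s → HasCyclicity (critical (𝒜 s)) 1)
    × (associated A₁ ≈ᴳ associated A₂)
    × (∀ s → HasCyclicity (associated (𝒜 s)) 1)
    × CSRData 𝒜
    × (∀ (d : CSRData 𝒜) t → 2 ≤ t → ¬ IsCSR d (t + 1) (A₁ ^ t ⊗ A₂))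
    × (∀ N → ∃[ k ] N ≤ k × (Σ[ w ∈ Vec (Fin 2) k ] (∀ (d : CSRData 𝒜) → ¬ IsCSR d k (product (map 𝒜 w)))))
mainTheorem6 =
    critical-𝒜
  , (λ s → ≈loops⇒hasCyclicity-1 (critical-𝒜 s))
  , ( (λ _ → mk⇔ id id)
    , λ i j → mk⇔ (example-support _ _ i j) (example-support _ _ i j))
  , associated-𝒜-hasCyclicity
  , csrData
  , (λ d t _ → fast⇒¬CSR d (t + 1) (slow-⊗-fast (slow-A₁^ t) fast-A₂))
  , (λ N → suc N , ℕ.n≤1+n N , word N , λ d → fast⇒¬CSR d (suc N) (fast-word N))
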